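{- The logic $\mathsf{CS4}$ has the finite model property: for every formula $\varphi$, if $\mathsf{CS4}\nvdash\varphi$, then there is a $\mathsf{CS4}$-model $\mathcal M=(W,W_\bot,\preccurlyeq,\sqsubseteq,V)$ with $W$ finite such that $\mathcal M\not\models\varphi$. (Conversely, every theorem of $\mathsf{CS4}$ is valid on all $\mathsf{CS4}$-models.)
   Context: Fix a countably infinite set $\mathbb P$ of propositional variables. Formulas: $\varphi,\psi ::= p\mid\bot\mid(\varphi\wedge\psi)\mid(\varphi\vee\psi)\mid(\varphi\to\psi)\mid\Diamond\varphi\mid\Box\varphi$ with $p\in\mathbb P$; $\neg\varphi:=\varphi\to\bot$. A bi-intuitionistic frame is $\mathcal F=(W,W_\bot,\preccurlyeq,\sqsubseteq)$ where $\preccurlyeq$ and $\sqsubseteq$ are preorders on a set $W$ and $W_\bot\subseteq W$ (the fallible worlds) is upward closed under both $\preccurlyeq$ and $\sqsubseteq$; it is infallible if $W_\bot=\varnothing$. A valuation is a map $V:\mathbb P\to 2^W$ such that each $V(p)$ is upward closed under $\preccurlyeq$ and $W_\bot\subseteq V(p)$; a model is $\mathcal M=(W,W_\bot,\preccurlyeq,\sqsubseteq,V)$. Satisfaction: $(\mathcal M,w)\models p$ iff $w\in V(p)$; $(\mathcal M,w)\models\bot$ iff $w\in W_\bot$; $\wedge,\vee$ pointwise; $(\mathcal M,w)\models\varphi\to\psi$ iff for all $v\succcurlyeq w$, $(\mathcal M,v)\models\varphi$ implies $(\mathcal M,v)\models\psi$; $(\mathcal M,w)\models\Diamond\varphi$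 iff for all $u\succcurlyeq w$ there is $v\sqsupseteq u$ with $(\mathcal M,v)\models\varphi$; $(\mathcal M,w)\models\Box\varphi$ iff for all $u,v$ with $w\preccurlyeq u\sqsubseteq v$, $(\mathcal M,v)\models\varphi$. $\mathcal M\models\varphi$ means $(\mathcal M,w)\models\varphi$ for all $w\in W\setminus W_\bot$. For $R\subseteq W\times W$ (relative to $\preccurlyeq$): $R$ is backward confluent if $wRv\preccurlyeq v'$ implies there is $w'$ with $w\preccurlyeq w'Rv'$. A $\mathsf{CS4}$-frame is a bi-intuitionistic frame in which $\sqsubseteq$ is backward confluent; a $\mathsf{CS4}$-model is a model on such a frame. $\mathsf{CS4}$ is the least set of formulas containing all intuitionistic propositional tautologies (in this language) and all instances of $\Box(\varphi\to\psi)\to(\Box\varphi\to\Box\psi)$, $\Box(\varphi\to\psi)\to(\Diamond\varphi\to\Diamond\psi)$, $\Box\varphi\to\varphi$, $\varphi\to\Diamond\varphi$, $\Box\varphi\to\Box\Box\varphi$, $\Diamond\Diamond\varphi\to\Diamond\varphi$, closed under modus ponens and necessitation (from $\varphi$ infer $\Box\varphi$). -}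

module Defs where

open import Data.Fin using (Fin)
open import Data.Nat using (ℕ)
open import Data.Product using (∃; _×_)
open import Data.Sum using (_⊎_)
open import Function.Bundles using (_↔_)
open import Level using (0ℓ)
open import Relation.Binary using (Rel; IsPreorder; _Respects_)
open import Relation.Binary.PropositionalEquality using (_≡_)
open import Relation.Nullary using (¬_)
open import Relation.Unary using (Pred; _⊆_)

infixr 7 _∧_
infixr 6 _∨_
infixr 5 _⇒_
infix  8 ◇_ □_

-- The countably infinite set of propositional variables is ℕ.
data Formula : Set where
  var         : ℕ → Formula
  ⊥′          : Formula
  _∧_ _∨_ _⇒_ : Formula → Formula → Formula
  ◇_ □_       : Formula → Formula

infix 2 IPC⊢_ CS4⊢_

-- Intuitionistic propositional tautologies in the modal language, in Hilbert
-- style: no axiom mentions ◇ or □, so modal formulas behave as atoms.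
data IPC⊢_ : Formula → Set where
  K    : ∀ {φ ψ} → IPC⊢ φ ⇒ (ψ ⇒ φ)
  S    : ∀ {φ ψ χ} → IPC⊢ (φ ⇒ (ψ ⇒ χ)) ⇒ ((φ ⇒ ψ) ⇒ (φ ⇒ χ))
  ∧-I  : ∀ {φ ψ} → IPC⊢ φ ⇒ (ψ ⇒ (φ ∧ ψ))
  ∧-E₁ : ∀ {φ ψ} → IPC⊢ (φ ∧ ψ) ⇒ φ
  ∧-E₂ : ∀ {φ ψ} → IPC⊢ (φ ∧ ψ) ⇒ ψ
  ∨-I₁ : ∀ {φ ψ} → IPC⊢ φ ⇒ (φ ∨ ψ)
  ∨-I₂ : ∀ {φ ψ} → IPC⊢ ψ ⇒ (φ ∨ ψ)
  ∨-E  : ∀ {φ ψ χ} → IPC⊢ (φ ⇒ χ) ⇒ ((ψ ⇒ χ) ⇒ ((φ ∨ ψ) ⇒ χ))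
  ⊥-E  : ∀ {φ} → IPC⊢ ⊥′ ⇒ φ
  MP   : ∀ {φ ψ} → IPC⊢ φ ⇒ ψ → IPC⊢ φ → IPC⊢ ψ

data CS4⊢_ : Formula → Set where
  taut : ∀ {φ} → IPC⊢ φ → CS4⊢ φ
  K□   : ∀ {φ ψ} → CS4⊢ □ (φ ⇒ ψ) ⇒ (□ φ ⇒ □ ψ)
  K◇   : ∀ {φ ψ} → CS4⊢ □ (φ ⇒ ψ) ⇒ (◇ φ ⇒ ◇ ψ)
  T□   : ∀ {φ} → CS4⊢ □ φ ⇒ φ
  T◇   : ∀ {φ} → CS4⊢ φ ⇒ ◇ φ
  4□   : ∀ {φ} → CS4⊢ □ φ ⇒ □ □ φ
  4◇   : ∀ {φ} → CS4⊢ ◇ ◇ φ ⇒ ◇ φ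
  MP   : ∀ {φ ψ} → CS4⊢ φ ⇒ ψ → CS4⊢ φ → CS4⊢ ψ
  Nec  : ∀ {φ} → CS4⊢ φ → CS4⊢ □ φ

-- P Respects R says that P is upward closed under R.
record Frame : Set₁ where
  infix 4 _≼_ _⊑_
  field
    W            : Set
    W⊥           : Pred W 0ℓ
    _≼_ _⊑_      : Rel W 0ℓ
    ≼-isPreorder : IsPreorder _≡_ _≼_
    ⊑-isPreorder : IsPreorder _≡_ _⊑_
    W⊥-≼-closed  : W⊥ Respects _≼_
    W⊥-⊑-closed  : W⊥ Respects _⊑_

record Model : Set₁ where
  field
    frame : Frame
  open Frame frame public
  field
    V          : ℕ → Pred W 0ℓ
    V-≼-closed : ∀ p → V p Respects _≼_
    W⊥⊆V       : ∀ p → W⊥ ⊆ V p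

infix 3 ⟨_,_⟩⊨_ _⊨_

⟨_,_⟩⊨_ : (M : Model) → Model.W M → Formula → Set
⟨ M , w ⟩⊨ var p   = Model.V M p w
⟨ M , w ⟩⊨ ⊥′      = Model.W⊥ M w
⟨ M , w ⟩⊨ (φ ∧ ψ) = (⟨ M , w ⟩⊨ φ) × (⟨ M , w ⟩⊨ ψ)
⟨ M , w ⟩⊨ (φ ∨ ψ) = (⟨ M , w ⟩⊨ φ) ⊎ (⟨ M , w ⟩⊨ ψ)
⟨ M , w ⟩⊨ (φ ⇒ ψ) = let open Model M in
  ∀ v → w ≼ v → ⟨ M , v ⟩⊨ φ → ⟨ M , v ⟩⊨ ψ
⟨ M , w ⟩⊨ ◇ φ     = let open Model M in
  ∀ u → w ≼ u → ∃ λ v → (u ⊑ v) × (⟨ M , v ⟩⊨ φ)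
⟨ M , w ⟩⊨ □ φ     = let open Model M in
  ∀ u v → w ≼ u → u ⊑ v → ⟨ M , v ⟩⊨ φ

_⊨_ : Model → Formula → Set
M ⊨ φ = ∀ w → ¬ Model.W⊥ M w → ⟨ M , w ⟩⊨ φ

BackwardConfluent : {W : Set} → Rel W 0ℓ → Rel W 0ℓ → Set
BackwardConfluent _≼_ R =
  ∀ {w v v′} → R w v → v ≼ v′ → ∃ λ w′ → (w ≼ w′) × R w′ v′

IsCS4Frame : Frame → Set
IsCS4Frame F = BackwardConfluent _≼_ _⊑_
  where open Frame F

record CS4Model : Set₁ where
  field
    model      : Model
    isCS4Frame : IsCS4Frame (Model.frame model)
  open Model model public

Finite : Set → Set
Finite A = ∃ λ n → A ↔ Fin n

{-# OPTIONS --safe #-}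

-- Let Φ be the set consisting of ⊥ and the subformulas of φ.  A world of the finite
-- canonical model is a prime Φ-theory Γ together with at most one promise: a formula
-- ψ of Φ with Γ ⊬ ◇ψ, which has to stay false along ⊑.  The order ≼ is inclusion of
-- theories and ignores promises; ⊑ preserves the promise and the boxed formulas of Γ.
-- Adding the promise ψ to a world is a ≼-step and refutes ◇ψ, and dropping the
-- promise, also a ≼-step, gives backward confluence.  The inconsistent theory Φ lies
-- ⊑-above every world without a promise, so ◇ψ can only fail because of a promise.
--
-- Primality of a subset of Φ is not decidable a priori, so the carrier consists of
-- all pairs (subset, promise), and pairs that are not worlds are isolated points.
-- Since ¬ (M ⊨ φ) is a negation, the finitely many instances of excluded middle
-- needed for the Lindenbaum construction are available when proving it.
module Submission where

open import Data.Bool using (true)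
open import Data.Fin using (Fin)
open import Data.Fin.Properties using (1↔⊤; 2↔Bool; +↔⊎; *↔×; any?; sequence)
open import Data.Fin.Subset
  using (Subset; ⁅_⁆; _∈_; _⊆_; _⊃_; _∪_; _∩_) renaming (⊥ to ∅; ⊤ to full)
open import Data.Fin.Subset.Induction using (⊃-wellFounded; Acc; acc)
open import Data.Fin.Subset.Properties
  using (_∈?_; ∉⊥; ∈⊤; ⊆⊤; ⊆-refl; ⊆-trans; x∈⁅x⁆; x∈⁅y⁆⇒x≡y; p⊆p∪q; q⊆p∪q; x∈p∪q⁻;
         p∩q⊆p; p∩q⊆q; x∈p∩q⁺)
open import Data.List using (List; []; _∷_; _++_; lookup)
import Data.List.Membership.Propositional as List
open import Data.List.Relation.Unary.All using (All; _∷_; head; tabulate)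
open import Data.List.Relation.Unary.All.Properties using (++⁻)
open import Data.List.Relation.Unary.Any using (here; there; index)
open import Data.List.Relation.Unary.Any.Properties using (lookup-index)
open import Data.Maybe using (Maybe; just; nothing; maybe)
import Data.Maybe.Relation.Unary.All as Maybe using (All; just; nothing)
open import Data.Nat using (ℕ; zero; suc)
open import Data.Product using (∃; _×_; _,_; proj₁; proj₂; Σ-syntax; uncurry)
open import Data.Product.Function.NonDependent.Propositional using (_×-↔_; _×-⇔_)
open import Data.Sum as Sum using (_⊎_; inj₁; inj₂; [_,_]′)
open import Data.Sum.Function.Propositional using (_⊎-↔_; _⊎-⇔_)
open import Data.Unit using (⊤; tt)
open import Data.Vec as Vec using (Vec; []; _∷_)
open import Data.Vec.Properties using (lookup∘tabulate; lookup⇒[]=; []=⇒lookup)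
open import Effect.Monad using (RawMonad)
open import Function using (_∘_; id; const)
open import Function.Bundles using (_↔_; _⇔_; mk↔ₛ′; mk⇔; module Inverse; module Equivalence)
open import Function.Construct.Composition using (_⇔-∘_)
open import Function.Properties.Inverse using (↔-refl; ↔-sym; ↔-trans)
open import Function.Related.TypeIsomorphisms using (→-cong-⇔)
open import Level using (Level; 0ℓ)
open import Relation.Binary using (Rel; IsPreorder; Reflexive; Transitive; _Respects_)
import Relation.Binary.Construct.Add.Infimum.NonStrict as AddInfimum
open import Relation.Binary.Construct.Closure.Reflexive using (ReflClosure; refl; [_])
open import Relation.Binary.Construct.Closure.Reflexive.Properties using (isPreorder; resp)
open import Relation.Binary.PropositionalEquality using (_≡_; refl; sym; trans; subst)
open import Relation.Nullary using (¬_; Dec; yes; no; does; proof; Reflects; invert; contradiction)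
open import Relation.Nullary.Decidable
  using (¬?; _×-dec_; dec-true; decidable-stable; ¬¬-excluded-middle)
open import Relation.Nullary.Negation using (¬¬-Monad; ¬¬-map)
import Relation.Unary as U
open import Relation.Unary using (Pred; Decidable)
open import Defs

private
  variable
    a p q r ℓ : Level
    n         : ℕ
    φ ψ χ θ   : Formula

-- Soundness

module _ (M : Model) where
  open Model M

  private
    module ≼ = IsPreorder ≼-isPreorder
    module ⊑ = IsPreorder ⊑-isPreorder

  ⊨-≼-closed : ∀ φ → (⟨ M ,_⟩⊨ φ) Respects _≼_
  ⊨-≼-closed (var p) w≼v ⊨p          = V-≼-closed p w≼v ⊨p
  ⊨-≼-closed ⊥′      w≼v ⊨⊥          = W⊥-≼-closed w≼v ⊨⊥
  ⊨-≼-closed (φ ∧ ψ) w≼v (⊨φ , ⊨ψ)   = ⊨-≼-closed φ w≼v ⊨φ , ⊨-≼-closed ψ w≼v ⊨ψ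
  ⊨-≼-closed (φ ∨ ψ) w≼v (inj₁ ⊨φ)   = inj₁ (⊨-≼-closed φ w≼v ⊨φ)
  ⊨-≼-closed (φ ∨ ψ) w≼v (inj₂ ⊨ψ)   = inj₂ (⊨-≼-closed ψ w≼v ⊨ψ)
  ⊨-≼-closed (φ ⇒ ψ) w≼v ⊨φ⇒ψ u v≼u  = ⊨φ⇒ψ u (≼.trans w≼v v≼u)
  ⊨-≼-closed (◇ φ)   w≼v ⊨◇φ u v≼u   = ⊨◇φ u (≼.trans w≼v v≼u)
  ⊨-≼-closed (□ φ)   w≼v ⊨□φ u t v≼u = ⊨□φ u t (≼.trans w≼v v≼u)

  W⊥⊆⊨ : ∀ φ → W⊥ U.⊆ (⟨ M ,_⟩⊨ φ)
  W⊥⊆⊨ (var p) w∈W⊥             = W⊥⊆V p w∈W⊥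
  W⊥⊆⊨ ⊥′      w∈W⊥             = w∈W⊥
  W⊥⊆⊨ (φ ∧ ψ) w∈W⊥             = W⊥⊆⊨ φ w∈W⊥ , W⊥⊆⊨ ψ w∈W⊥
  W⊥⊆⊨ (φ ∨ ψ) w∈W⊥             = inj₁ (W⊥⊆⊨ φ w∈W⊥)
  W⊥⊆⊨ (φ ⇒ ψ) w∈W⊥ v w≼v _     = W⊥⊆⊨ ψ (W⊥-≼-closed w≼v w∈W⊥)
  W⊥⊆⊨ (◇ φ)   w∈W⊥ u w≼u       = u , ⊑.refl , W⊥⊆⊨ φ (W⊥-≼-closed w≼u w∈W⊥)
  W⊥⊆⊨ (□ φ)   w∈W⊥ u v w≼u u⊑v = W⊥⊆⊨ φ (W⊥-⊑-closed u⊑v (W⊥-≼-closed w≼u w∈W⊥))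

  IPC-sound : IPC⊢ φ → ∀ w → ⟨ M , w ⟩⊨ φ
  IPC-sound (K {φ}) w _ _ ⊨φ u v≼u _ = ⊨-≼-closed φ v≼u ⊨φ
  IPC-sound S w _ _ ⊨φ⇒ψ⇒χ _ v≼u ⊨φ⇒ψ t u≼t ⊨φ =
    ⊨φ⇒ψ⇒χ t (≼.trans v≼u u≼t) ⊨φ t ≼.refl (⊨φ⇒ψ t u≼t ⊨φ)
  IPC-sound (∧-I {φ}) w _ _ ⊨φ _ v≼u ⊨ψ = ⊨-≼-closed φ v≼u ⊨φ , ⊨ψ
  IPC-sound ∧-E₁ w _ _ = proj₁
  IPC-sound ∧-E₂ w _ _ = proj₂
  IPC-sound ∨-I₁ w _ _ = inj₁
  IPC-sound ∨-I₂ w _ _ = inj₂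
  IPC-sound ∨-E w _ _ ⊨φ⇒χ _ v≼u ⊨ψ⇒χ t u≼t =
    [ ⊨φ⇒χ t (≼.trans v≼u u≼t) , ⊨ψ⇒χ t u≼t ]′
  IPC-sound (⊥-E {φ}) w _ _ = W⊥⊆⊨ φ
  IPC-sound (MP ⊢φ⇒ψ ⊢φ) w = IPC-sound ⊢φ⇒ψ w w ≼.refl (IPC-sound ⊢φ w)

module _ (M : CS4Model) where
  open CS4Model M

  private
    module ≼ = IsPreorder ≼-isPreorder
    module ⊑ = IsPreorder ⊑-isPreorder

  CS4-sound : CS4⊢ φ → ∀ w → ⟨ model , w ⟩⊨ φ
  CS4-sound (taut ⊢φ) = IPC-sound model ⊢φ
  CS4-sound K□ w _ _ ⊨□φ⇒ψ _ v≼u ⊨□φ s t u≼s s⊑t =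
    ⊨□φ⇒ψ s t (≼.trans v≼u u≼s) s⊑t t ≼.refl (⊨□φ s t u≼s s⊑t)
  CS4-sound K◇ w _ _ ⊨□φ⇒ψ _ v≼u ⊨◇φ s u≼s =
    let t , s⊑t , ⊨φ = ⊨◇φ s u≼s
    in  t , s⊑t , ⊨□φ⇒ψ s t (≼.trans v≼u u≼s) s⊑t t ≼.refl ⊨φ
  CS4-sound T□ w v _ ⊨□φ = ⊨□φ v v ≼.refl ⊑.refl
  CS4-sound (T◇ {φ}) w _ _ ⊨φ u v≼u = u , ⊑.refl , ⊨-≼-closed model φ v≼u ⊨φ
  CS4-sound 4□ w _ _ ⊨□φ _ _ v≼s s⊑t _ u t≼r r⊑u =
    let s′ , s≼s′ , s′⊑r = isCS4Frame s⊑t t≼r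
    in  ⊨□φ s′ u (≼.trans v≼s s≼s′) (⊑.trans s′⊑r r⊑u)
  CS4-sound 4◇ w _ _ ⊨◇◇φ u v≼u =
    let s , u⊑s , ⊨◇φ = ⊨◇◇φ u v≼u
        t , s⊑t , ⊨φ  = ⊨◇φ s ≼.refl
    in  t , ⊑.trans u⊑s s⊑t , ⊨φ
  CS4-sound (MP ⊢φ⇒ψ ⊢φ) w = CS4-sound ⊢φ⇒ψ w w ≼.refl (CS4-sound ⊢φ w)
  CS4-sound (Nec ⊢φ) w _ v _ _ = CS4-sound ⊢φ v

-- Derivability from a context

Context : Set₁
Context = Pred Formula 0ℓ

infix 4 _⊢_

data _⊢_ (Γ : Context) : Formula → Set where
  hyp : Γ φ → Γ ⊢ φ
  thm : CS4⊢ φ → Γ ⊢ φ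
  mp  : Γ ⊢ φ ⇒ ψ → Γ ⊢ φ → Γ ⊢ ψ

private
  variable
    Γ Δ : Context

ax : IPC⊢ φ → Γ ⊢ φ
ax = thm ∘ taut

weaken : Γ U.⊆ Δ → Γ ⊢ φ → Δ ⊢ φ
weaken Γ⊆Δ (hyp φ∈Γ)    = hyp (Γ⊆Δ φ∈Γ)
weaken Γ⊆Δ (thm ⊢φ)     = thm ⊢φ
weaken Γ⊆Δ (mp ⊢φ⇒ψ ⊢φ) = mp (weaken Γ⊆Δ ⊢φ⇒ψ) (weaken Γ⊆Δ ⊢φ)

deduction : Γ U.∪ U.｛ φ ｝ ⊢ ψ → Γ ⊢ φ ⇒ ψ
deduction (hyp (inj₁ ψ∈Γ))          = mp (ax K) (hyp ψ∈Γ)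
deduction {φ = φ} (hyp (inj₂ refl)) = mp (mp (ax S) (ax K)) (ax (K {ψ = φ}))
deduction (thm ⊢ψ)                  = mp (ax K) (thm ⊢ψ)
deduction (mp ⊢χ⇒ψ ⊢χ)              = mp (mp (ax S) (deduction ⊢χ⇒ψ)) (deduction ⊢χ)

⊢-closed : U.Empty Γ → Γ ⊢ φ → CS4⊢ φ
⊢-closed Γ≡∅ (hyp φ∈Γ)    = contradiction φ∈Γ (Γ≡∅ _)
⊢-closed Γ≡∅ (thm ⊢φ)     = ⊢φ
⊢-closed Γ≡∅ (mp ⊢φ⇒ψ ⊢φ) = MP (⊢-closed Γ≡∅ ⊢φ⇒ψ) (⊢-closed Γ≡∅ ⊢φ)

ex-falso : Γ ⊢ ⊥′ → Γ ⊢ φ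
ex-falso = mp (ax ⊥-E)

⊢∧⇔⊢×⊢ : Γ ⊢ φ ∧ ψ ⇔ (Γ ⊢ φ × Γ ⊢ ψ)
⊢∧⇔⊢×⊢ = mk⇔ (λ ⊢φ∧ψ → mp (ax ∧-E₁) ⊢φ∧ψ , mp (ax ∧-E₂) ⊢φ∧ψ)
             (λ (⊢φ , ⊢ψ) → mp (mp (ax ∧-I) ⊢φ) ⊢ψ)

∨-elim : Γ ⊢ φ ⇒ χ → Γ ⊢ ψ ⇒ χ → Γ ⊢ φ ∨ ψ → Γ ⊢ χ
∨-elim ⊢φ⇒χ ⊢ψ⇒χ = mp (mp (mp (ax ∨-E) ⊢φ⇒χ) ⊢ψ⇒χ)

◇-bind : Γ ⊢ □ (φ ⇒ ◇ ψ) → Γ ⊢ ◇ φ → Γ ⊢ ◇ ψ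
◇-bind ⊢□φ⇒◇ψ ⊢◇φ = mp (thm 4◇) (mp (mp (thm K◇) ⊢□φ⇒◇ψ) ⊢◇φ)

-- ⊥ is included because fallibility, too, is preserved by ⊑.
data Persistent : Formula → Set where
  □-persistent : Persistent (□ φ)
  ⊥-persistent : Persistent ⊥′

persistent? : Decidable Persistent
persistent? (var _) = no λ ()
persistent? ⊥′      = yes ⊥-persistent
persistent? (_ ∧ _) = no λ ()
persistent? (_ ∨ _) = no λ ()
persistent? (_ ⇒ _) = no λ ()
persistent? (◇ _)   = no λ ()
persistent? (□ _)   = yes □-persistent

persistent⇒□ : Persistent φ → CS4⊢ φ ⇒ □ φ
persistent⇒□ □-persistent = 4□
persistent⇒□ ⊥-persistent = taut ⊥-E

persistent-nec : Γ U.⊆ Persistent → Γ ⊢ φ → Γ ⊢ □ φ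
persistent-nec Γ⊆P (hyp φ∈Γ)    = mp (thm (persistent⇒□ (Γ⊆P φ∈Γ))) (hyp φ∈Γ)
persistent-nec Γ⊆P (thm ⊢φ)     = thm (Nec ⊢φ)
persistent-nec Γ⊆P (mp ⊢φ⇒ψ ⊢φ) = mp (mp (thm K□) (persistent-nec Γ⊆P ⊢φ⇒ψ)) (persistent-nec Γ⊆P ⊢φ)

-- Finite types and their subsets

×-finite : ∀ {A B} → Finite A → Finite B → Finite (A × B)
×-finite (_ , A↔Fin) (_ , B↔Fin) = _ , ↔-trans (A↔Fin ×-↔ B↔Fin) (↔-sym *↔×)

Maybe-finite : ∀ {A} → Finite A → Finite (Maybe A)
Maybe-finite {A} (_ , A↔Fin) =
  _ , ↔-trans Maybe↔⊤⊎ (↔-trans (↔-sym 1↔⊤ ⊎-↔ A↔Fin) (↔-sym +↔⊎))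
  where
  Maybe↔⊤⊎ : Maybe A ↔ (⊤ ⊎ A)
  Maybe↔⊤⊎ = mk↔ₛ′ (maybe inj₂ (inj₁ tt)) [ const nothing , just ]′
    (λ { (inj₁ _) → refl ; (inj₂ _) → refl }) λ { (just _) → refl ; nothing → refl }

Vec-finite : ∀ {A} → Finite A → ∀ n → Finite (Vec A n)
Vec-finite {A} _ zero = 1 , ↔-trans Vec0↔⊤ (↔-sym 1↔⊤)
  where
  Vec0↔⊤ : Vec A zero ↔ ⊤
  Vec0↔⊤ = mk↔ₛ′ (const tt) (const []) (λ _ → refl) λ { [] → refl }
Vec-finite {A} A-finite (suc n) with ×-finite A-finite (Vec-finite A-finite n)
... | m , A×Vec↔Fin = m , ↔-trans uncons A×Vec↔Fin
  where
  uncons : Vec A (suc n) ↔ (A × Vec A n)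
  uncons = mk↔ₛ′ (λ xs → Vec.head xs , Vec.tail xs) (uncurry _∷_) (λ _ → refl) λ { (_ ∷ _) → refl }

Subset-finite : ∀ n → Finite (Subset n)
Subset-finite = Vec-finite (2 , ↔-sym 2↔Bool)

¬¬-decidable : ∀ {A} → Finite A → (P : Pred A 0ℓ) → ¬ ¬ Decidable P
¬¬-decidable (_ , A↔Fin) P =
  ¬¬-map (λ P∘from? x → subst (Dec ∘ P) (strictlyInverseʳ x) (P∘from? (to x)))
         (sequence (RawMonad.rawApplicative ¬¬-Monad) λ i → ¬¬-excluded-middle {A = P (from i)})
  where open Inverse A↔Fin

module _ {P : Pred (Fin n) p} (P? : Decidable P) where

  comprehension : Subset n
  comprehension = Vec.tabulate (does ∘ P?)

  lookup-comprehension : ∀ i → Vec.lookup comprehension i ≡ does (P? i)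
  lookup-comprehension = lookup∘tabulate (does ∘ P?)

  ∈-comprehension⁺ : ∀ {i} → P i → i ∈ comprehension
  ∈-comprehension⁺ {i} Pi =
    lookup⇒[]= i comprehension (trans (lookup-comprehension i) (dec-true (P? i) Pi))

  ∈-comprehension⁻ : ∀ {i} → i ∈ comprehension → P i
  ∈-comprehension⁻ {i} i∈ = invert (subst (Reflects (P i)) does≡true (proof (P? i)))
    where
    does≡true : does (P? i) ≡ true
    does≡true = trans (sym (lookup-comprehension i)) ([]=⇒lookup i∈)

p∪⁅i⁆⊆q⇒p⊆q×i∈q : ∀ {p q : Subset n} {i} → p ∪ ⁅ i ⁆ ⊆ q → p ⊆ q × i ∈ q
p∪⁅i⁆⊆q⇒p⊆q×i∈q {p = p} {i = i} p∪i⊆q = p∪i⊆q ∘ p⊆p∪q ⁅ i ⁆ , p∪i⊆q (q⊆p∪q p ⁅ i ⁆ (x∈⁅x⁆ i))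

maximal-superset : {P : Pred (Subset n) ℓ} → Decidable P → ∀ p → P p →
                   Σ[ q ∈ Subset n ] p ⊆ q × P q × (∀ i → i ∈ q ⊎ ¬ P (q ∪ ⁅ i ⁆))
maximal-superset {n} {P = P} P? p = go p (⊃-wellFounded p)
  where
  go : ∀ p → Acc _⊃_ p → P p → Σ[ q ∈ Subset n ] p ⊆ q × P q × (∀ i → i ∈ q ⊎ ¬ P (q ∪ ⁅ i ⁆))
  go p (acc rec) Pp with any? (λ i → ¬? (i ∈? p) ×-dec P? (p ∪ ⁅ i ⁆))
  ... | yes (i , i∉p , Pp∪i) =
    let p⊆p∪i , i∈p∪i = p∪⁅i⁆⊆q⇒p⊆q×i∈q id
        q , p∪i⊆q , Pq , max = go (p ∪ ⁅ i ⁆) (rec (p⊆p∪i , i , i∈p∪i , i∉p)) Pp∪i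
    in  q , p∪i⊆q ∘ p⊆p∪i , Pq , max
  ... | no ∄i = p , id , Pp , max
    where
    max : ∀ i → i ∈ p ⊎ ¬ P (p ∪ ⁅ i ⁆)
    max i with i ∈? p
    ... | yes i∈p = inj₁ i∈p
    ... | no  i∉p = inj₂ λ Pp∪i → ∄i (i , i∉p , Pp∪i)

-- Isolating the points outside a predicate

infix 5 _↾_

_↾_ : {A : Set a} → Rel A ℓ → Pred A p → Rel A _
R ↾ P = ReflClosure λ x y → P x × P y × R x y

module _ {A : Set a} {P : Pred A p} where

  ↾-isPreorder : {R : Rel A ℓ} → Transitive R → IsPreorder _≡_ (R ↾ P)
  ↾-isPreorder R-trans = isPreorder λ (Px , _ , xRy) (_ , Pz , yRz) → Px , Pz , R-trans xRy yRz

  ↾-closed : {R : Rel A ℓ} → P Respects (R ↾ P)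
  ↾-closed = resp λ (_ , Py , _) _ → Py

  ↾⇒ : {R : Rel A ℓ} → Reflexive R → ∀ {x y} → (R ↾ P) x y → R x y
  ↾⇒ R-refl refl            = R-refl
  ↾⇒ R-refl [ _ , _ , xRy ] = xRy

  ∩-↾-closed : {R : Rel A ℓ} {Q : Pred A q} →
               (∀ {x y} → P x → R x y → Q x → Q y) → (P U.∩ Q) Respects (R ↾ P)
  ∩-↾-closed Q-closed = resp λ (Px , Py , xRy) (_ , Qx) → Py , Q-closed Px xRy Qx

↾-backwardConfluent : {A : Set} {P : Pred A 0ℓ} {_≤_ R : Rel A 0ℓ} →
  (∀ {x y z} → P x → R x y → y ≤ z → ∃ λ w → P w × x ≤ w × R w z) →
  BackwardConfluent (_≤_ ↾ P) (R ↾ P)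
↾-backwardConfluent confluent xRy refl = _ , refl , xRy
↾-backwardConfluent confluent refl [ y≤z ] = _ , [ y≤z ] , refl
↾-backwardConfluent confluent [ Px , _ , xRy ] [ _ , Pz , y≤z ] =
  let w , Pw , x≤w , wRz = confluent Px xRy y≤z
  in  w , [ Px , Pw , x≤w ] , [ Pw , Pz , wRz ]

module _ {A : Set a} {P : Pred A p} {Q : Pred A q} {Q′ : Pred A r}
         (Q⇔Q′ : ∀ {x} → P x → Q x ⇔ Q′ x) where
  open Equivalence using (to; from)

  ∀-successor-cong : {R : Rel A ℓ} → P Respects R → ∀ {x} → P x →
                     (∀ y → R x y → Q y) ⇔ (∀ y → R x y → Q′ y)
  ∀-successor-cong R-closed Px =
    mk⇔ (λ ∀Q y xRy → to (Q⇔Q′ (R-closed xRy Px)) (∀Q y xRy))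
        (λ ∀Q′ y xRy → from (Q⇔Q′ (R-closed xRy Px)) (∀Q′ y xRy))

  ∃-successor-cong : {R : Rel A ℓ} → P Respects R → ∀ {x} → P x →
                     (∃ λ y → R x y × Q y) ⇔ (∃ λ y → R x y × Q′ y)
  ∃-successor-cong R-closed Px =
    mk⇔ (λ (y , xRy , Qy) → y , xRy , to (Q⇔Q′ (R-closed xRy Px)) Qy)
        (λ (y , xRy , Q′y) → y , xRy , from (Q⇔Q′ (R-closed xRy Px)) Q′y)

  ∀∀-successor-cong : {R S : Rel A ℓ} → P Respects R → P Respects S → ∀ {x} → P x →
                      (∀ y z → R x y → S y z → Q z) ⇔ (∀ y z → R x y → S y z → Q′ z)
  ∀∀-successor-cong R-closed S-closed Px =
    mk⇔ (λ ∀Q y z xRy ySz → to (Q⇔Q′ (S-closed ySz (R-closed xRy Px))) (∀Q y z xRy ySz))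
        (λ ∀Q′ y z xRy ySz → from (Q⇔Q′ (S-closed ySz (R-closed xRy Px))) (∀Q′ y z xRy ySz))

-- Prime theories over a finite family of formulas

Range : {A B : Set} → (A → B) → Pred B 0ℓ
Range f y = ∃ λ x → f x ≡ y

∈⇒Range-lookup : {A : Set} {x : A} {xs : List A} → x List.∈ xs → Range (lookup xs) x
∈⇒Range-lookup x∈xs = index x∈xs , sym (lookup-index x∈xs)

module Theories (F : Fin n → Formula) where

  ⟦_⟧ : Subset n → Context
  ⟦ Γ ⟧ φ = ∃ λ i → i ∈ Γ × F i ≡ φ

  ∈⇒⊢ : ∀ {Γ i} → i ∈ Γ → ⟦ Γ ⟧ ⊢ F i
  ∈⇒⊢ i∈Γ = hyp (_ , i∈Γ , refl)

  ⊆⇒⊢ : ∀ {Γ Δ} → Γ ⊆ Δ → ⟦ Γ ⟧ ⊢ φ → ⟦ Δ ⟧ ⊢ φ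
  ⊆⇒⊢ Γ⊆Δ = weaken λ (i , i∈Γ , Fi≡φ) → i , Γ⊆Δ i∈Γ , Fi≡φ

  ∪-deduction : ∀ Γ i → ⟦ Γ ∪ ⁅ i ⁆ ⟧ ⊢ φ → ⟦ Γ ⟧ ⊢ F i ⇒ φ
  ∪-deduction Γ i = deduction ∘ weaken split
    where
    split : ⟦ Γ ∪ ⁅ i ⁆ ⟧ U.⊆ ⟦ Γ ⟧ U.∪ U.｛ F i ｝
    split (j , j∈Γ∪i , Fj≡φ) with x∈p∪q⁻ Γ ⁅ i ⁆ j∈Γ∪i
    ... | inj₁ j∈Γ = inj₁ (j , j∈Γ , Fj≡φ)
    ... | inj₂ j∈i with refl ← x∈⁅y⁆⇒x≡y i j∈i = inj₂ Fj≡φ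

  persistent : Subset n
  persistent = comprehension (persistent? ∘ F)

  ∩persistent-nec : ∀ Γ → ⟦ Γ ∩ persistent ⟧ ⊢ φ → ⟦ Γ ⟧ ⊢ □ φ
  ∩persistent-nec Γ = ⊆⇒⊢ (p∩q⊆p Γ persistent) ∘ persistent-nec
    λ { (i , i∈ , refl) → ∈-comprehension⁻ (persistent? ∘ F) (p∩q⊆q Γ persistent i∈) }

  record PrimeTheory (Γ : Subset n) : Set where
    field
      closed : ∀ {i} → ⟦ Γ ⟧ ⊢ F i → i ∈ Γ
      prime  : ∀ {i j} → ⟦ Γ ⟧ ⊢ F i ∨ F j → i ∈ Γ ⊎ j ∈ Γ

  open PrimeTheory

  prime-⊢∨⇔⊢⊎⊢ : ∀ {Γ} → PrimeTheory Γ → Range F φ → Range F ψ →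
                 ⟦ Γ ⟧ ⊢ φ ∨ ψ ⇔ (⟦ Γ ⟧ ⊢ φ ⊎ ⟦ Γ ⟧ ⊢ ψ)
  prime-⊢∨⇔⊢⊎⊢ Γ-prime (_ , refl) (_ , refl) =
    mk⇔ (Sum.map ∈⇒⊢ ∈⇒⊢ ∘ prime Γ-prime) [ mp (ax ∨-I₁) , mp (ax ∨-I₂) ]′

  persistent-transfer : ∀ {Γ Δ} → PrimeTheory Γ → Γ ∩ persistent ⊆ Δ →
                        Range F φ → Persistent φ → ⟦ Γ ⟧ ⊢ φ → ⟦ Δ ⟧ ⊢ φ
  persistent-transfer Γ-prime ⊆Δ (_ , refl) φ-persistent ⊢φ =
    ∈⇒⊢ (⊆Δ (x∈p∩q⁺ (closed Γ-prime ⊢φ , ∈-comprehension⁺ (persistent? ∘ F) φ-persistent)))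

  full-prime : PrimeTheory full
  full-prime = record { closed = λ _ → ∈⊤ ; prime = λ _ → inj₁ ∈⊤ }

  lindenbaum : Decidable (λ Γ → ⟦ Γ ⟧ ⊢ θ) → ∀ Γ → ¬ (⟦ Γ ⟧ ⊢ θ) →
               Σ[ Δ ∈ Subset n ] Γ ⊆ Δ × PrimeTheory Δ × ¬ (⟦ Δ ⟧ ⊢ θ)
  lindenbaum {θ} ⊢θ? Γ Γ⊬θ with maximal-superset (¬? ∘ ⊢θ?) Γ Γ⊬θ
  ... | Δ , Γ⊆Δ , Δ⊬θ , max = Δ , Γ⊆Δ , record { closed = Δ-closed ; prime = Δ-prime } , Δ⊬θ
    where
    ∈-or-refutes : ∀ i → i ∈ Δ ⊎ ⟦ Δ ⟧ ⊢ F i ⇒ θ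
    ∈-or-refutes i = Sum.map₂ (∪-deduction Δ i ∘ decidable-stable (⊢θ? _)) (max i)

    Δ-closed : ∀ {i} → ⟦ Δ ⟧ ⊢ F i → i ∈ Δ
    Δ-closed {i} ⊢Fi with ∈-or-refutes i
    ... | inj₁ i∈Δ   = i∈Δ
    ... | inj₂ ⊢Fi⇒θ = contradiction (mp ⊢Fi⇒θ ⊢Fi) Δ⊬θ

    Δ-prime : ∀ {i j} → ⟦ Δ ⟧ ⊢ F i ∨ F j → i ∈ Δ ⊎ j ∈ Δ
    Δ-prime {i} {j} ⊢Fi∨Fj with ∈-or-refutes i | ∈-or-refutes j
    ... | inj₁ i∈Δ   | _          = inj₁ i∈Δ
    ... | inj₂ _     | inj₁ j∈Δ   = inj₂ j∈Δ
    ... | inj₂ ⊢Fi⇒θ | inj₂ ⊢Fj⇒θ = contradiction (∨-elim ⊢Fi⇒θ ⊢Fj⇒θ ⊢Fi∨Fj) Δ⊬θ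

  ⊢-prime-extensions⇒⊢ : Decidable (λ Γ → ⟦ Γ ⟧ ⊢ θ) → ∀ Γ →
                         (∀ {Δ} → Γ ⊆ Δ → PrimeTheory Δ → ⟦ Δ ⟧ ⊢ θ) → ⟦ Γ ⟧ ⊢ θ
  ⊢-prime-extensions⇒⊢ ⊢θ? Γ primes⊢θ = decidable-stable (⊢θ? Γ) λ Γ⊬θ →
    let _ , Γ⊆Δ , Δ-prime , Δ⊬θ = lindenbaum ⊢θ? Γ Γ⊬θ
    in  Δ⊬θ (primes⊢θ Γ⊆Δ Δ-prime)

-- The canonical model

subformulas properSubformulas : Formula → List Formula
subformulas φ = φ ∷ properSubformulas φ
properSubformulas (var _) = []
properSubformulas ⊥′      = []
properSubformulas (φ ∧ ψ) = subformulas φ ++ subformulas ψ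
properSubformulas (φ ∨ ψ) = subformulas φ ++ subformulas ψ
properSubformulas (φ ⇒ ψ) = subformulas φ ++ subformulas ψ
properSubformulas (◇ φ)   = subformulas φ
properSubformulas (□ φ)   = subformulas φ

module Canonical (F : Fin n → Formula) (⊥∈F : Range F ⊥′) where

  open Theories F
  open AddInfimum {A = Fin n} _≡_ using (_≤₋_; ⊥₋≤_; [_]; ≤₋-trans; ≤₋-reflexive-≡)

  W : Set
  W = Subset n × Maybe (Fin n)

  infix 4 _⊩_ _≼_ _⊑_

  _⊩_ : W → Formula → Set
  (Γ , _) ⊩ φ = ⟦ Γ ⟧ ⊢ φ

  record World (x : W) : Set where
    constructor _,_
    field
      primeTheory  : PrimeTheory (proj₁ x)
      keepsPromise : Maybe.All (λ i → ¬ (x ⊩ ◇ F i)) (proj₂ x)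

  open World

  unpromised : ∀ {Γ} → PrimeTheory Γ → World (Γ , nothing)
  unpromised Γ-prime = Γ-prime , Maybe.nothing

  _≼₀_ _⊑₀_ _≼_ _⊑_ : Rel W 0ℓ
  (Γ , _) ≼₀ (Δ , _) = Γ ⊆ Δ
  (Γ , d) ⊑₀ (Δ , e) = Γ ∩ persistent ⊆ Δ × d ≤₋ e
  _≼_ = _≼₀_ ↾ World
  _⊑_ = _⊑₀_ ↾ World

  World-≼-closed : World Respects _≼_
  World-≼-closed = ↾-closed

  World-⊑-closed : World Respects _⊑_
  World-⊑-closed = ↾-closed

  ⊑₀-refl : Reflexive _⊑₀_
  ⊑₀-refl {Γ , _} = p∩q⊆p Γ persistent , ≤₋-reflexive-≡ id refl

  ⊑₀-trans : Transitive _⊑₀_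
  ⊑₀-trans {Γ , _} (Γ∩⊆Δ , d≤e) (Δ∩⊆Θ , e≤f) =
    (λ i∈ → Δ∩⊆Θ (x∈p∩q⁺ (Γ∩⊆Δ i∈ , p∩q⊆q Γ persistent i∈))) , ≤₋-trans trans d≤e e≤f

  ⊑-backwardConfluent : BackwardConfluent _≼_ _⊑_
  ⊑-backwardConfluent = ↾-backwardConfluent λ {(Γ , _)} (Γ-prime , _) (Γ∩⊆Δ , _) Δ⊆Θ →
    (Γ , nothing) , unpromised Γ-prime , id , ⊆-trans Γ∩⊆Δ Δ⊆Θ , ⊥₋≤ _

  canonical : CS4Model
  canonical = record
    { model = record
      { frame      = record
        { W            = W
        ; W⊥           = World U.∩ (_⊩ ⊥′)
        ; _≼_          = _≼_
        ; _⊑_          = _⊑_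
        ; ≼-isPreorder = ↾-isPreorder ⊆-trans
        ; ⊑-isPreorder = ↾-isPreorder ⊑₀-trans
        ; W⊥-≼-closed  = ∩-↾-closed λ _ → ⊆⇒⊢
        ; W⊥-⊑-closed  = ∩-↾-closed λ (Γ-prime , _) (Γ∩⊆Δ , _) →
            persistent-transfer Γ-prime Γ∩⊆Δ ⊥∈F ⊥-persistent
        }
      ; V          = λ p → World U.∩ (_⊩ var p)
      ; V-≼-closed = λ _ → ∩-↾-closed λ _ → ⊆⇒⊢
      ; W⊥⊆V       = λ _ (x , ⊢⊥) → x , ex-falso ⊢⊥
      }
    ; isCS4Frame = ⊑-backwardConfluent
    }

  open CS4Model canonical using (model)

  canonical-finite : Finite W
  canonical-finite = ×-finite (Subset-finite n) (Maybe-finite (n , ↔-refl))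

  full-⊢ : ⟦ full ⟧ ⊢ φ
  full-⊢ = ex-falso (subst (⟦ full ⟧ ⊢_) (proj₂ ⊥∈F) (∈⇒⊢ ∈⊤))

  ⊩-≼-closed : (_⊩ φ) Respects _≼_
  ⊩-≼-closed = ⊆⇒⊢ ∘ ↾⇒ {R = _≼₀_} ⊆-refl

  promise-kept : ∀ {Γ i d} → World (Γ , d) → just i ≤₋ d → ¬ (⟦ Γ ⟧ ⊢ ◇ F i)
  promise-kept (_ , Maybe.just ⊬◇Fi) [ refl ] = ⊬◇Fi

  module TruthLemma (⊢?  : ∀ {χ} → Range F χ → Decidable (λ Γ → ⟦ Γ ⟧ ⊢ χ))
                    (⊢◇? : ∀ {χ} → Range F χ → Decidable (λ Γ → ⟦ Γ ⟧ ⊢ ◇ χ)) where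

    ⊩⇒⇔ : Range F φ → Range F ψ → ∀ {x} → World x →
          x ⊩ φ ⇒ ψ ⇔ (∀ y → x ≼ y → y ⊩ φ → y ⊩ ψ)
    ⊩⇒⇔ {ψ = ψ} (i , refl) ψ∈F {x@(Γ , _)} x-world = mk⇔ to from
      where
      to : x ⊩ F i ⇒ ψ → ∀ y → x ≼ y → y ⊩ F i → y ⊩ ψ
      to ⊢Fi⇒ψ _ x≼y = mp (⊩-≼-closed x≼y ⊢Fi⇒ψ)

      from : (∀ y → x ≼ y → y ⊩ F i → y ⊩ ψ) → x ⊩ F i ⇒ ψ
      from ≼-⊩ψ = ∪-deduction Γ i
        (⊢-prime-extensions⇒⊢ (⊢? ψ∈F) (Γ ∪ ⁅ i ⁆) λ {Δ} Γ∪i⊆Δ Δ-prime →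
          let Γ⊆Δ , i∈Δ = p∪⁅i⁆⊆q⇒p⊆q×i∈q Γ∪i⊆Δ
          in  ≼-⊩ψ (Δ , nothing) [ x-world , unpromised Δ-prime , Γ⊆Δ ] (∈⇒⊢ i∈Δ))

    ⊩□⇔ : Range F φ → Range F (□ φ) → ∀ {x} → World x →
          x ⊩ □ φ ⇔ (∀ y z → x ≼ y → y ⊑ z → z ⊩ φ)
    ⊩□⇔ {φ} φ∈F □φ∈F {x@(Γ , _)} x-world@(Γ-prime , _) = mk⇔ to from
      where
      to : x ⊩ □ φ → ∀ y z → x ≼ y → y ⊑ z → z ⊩ φ
      to ⊢□φ _ _ x≼y y⊑z =
        let Δ-prime , _ = World-≼-closed x≼y x-world
            Δ∩⊆Θ , _    = ↾⇒ ⊑₀-refl y⊑z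
        in  mp (thm T□) (persistent-transfer Δ-prime Δ∩⊆Θ □φ∈F □-persistent (⊩-≼-closed x≼y ⊢□φ))

      from : (∀ y z → x ≼ y → y ⊑ z → z ⊩ φ) → x ⊩ □ φ
      from ≼⊑-⊩φ = ∩persistent-nec Γ
        (⊢-prime-extensions⇒⊢ (⊢? φ∈F) (Γ ∩ persistent) λ {Δ} Γ∩⊆Δ Δ-prime →
          ≼⊑-⊩φ (Γ , nothing) (Δ , nothing)
            [ x-world , unpromised Γ-prime , id ]
            [ unpromised Γ-prime , unpromised Δ-prime , Γ∩⊆Δ , ⊥₋≤ nothing ])

    ◇-witness : Range F φ → ∀ {x} → World x → x ⊩ ◇ φ → ∃ λ y → x ⊑ y × y ⊩ φ
    ◇-witness φ∈F x-world@(_ , Maybe.nothing) _ =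
      (full , nothing) , [ x-world , unpromised full-prime , ⊆⊤ , ⊥₋≤ nothing ] , full-⊢
    ◇-witness (i , refl) {Γ , just j} x-world@(_ , Maybe.just Γ⊬◇Fj) ⊢◇Fi =
      let Δ , Γ∩∪i⊆Δ , Δ-prime , Δ⊬◇Fj = lindenbaum (⊢◇? (j , refl)) (Γ ∩ persistent ∪ ⁅ i ⁆) ⊬◇Fj
          Γ∩⊆Δ , i∈Δ = p∪⁅i⁆⊆q⇒p⊆q×i∈q Γ∩∪i⊆Δ
      in  (Δ , just j) , [ x-world , (Δ-prime , Maybe.just Δ⊬◇Fj) , Γ∩⊆Δ , [ refl ] ] , ∈⇒⊢ i∈Δ
      where
      ⊬◇Fj : ¬ (⟦ Γ ∩ persistent ∪ ⁅ i ⁆ ⟧ ⊢ ◇ F j)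
      ⊬◇Fj ⊢◇Fj = Γ⊬◇Fj (◇-bind (∩persistent-nec Γ (∪-deduction (Γ ∩ persistent) i ⊢◇Fj)) ⊢◇Fi)

    ⊩◇⇔ : Range F φ → ∀ {x} → World x →
          x ⊩ ◇ φ ⇔ (∀ y → x ≼ y → ∃ λ z → y ⊑ z × z ⊩ φ)
    ⊩◇⇔ φ∈F@(i , refl) {x@(Γ , _)} x-world@(Γ-prime , _) = mk⇔ to from
      where
      to : x ⊩ ◇ F i → ∀ y → x ≼ y → ∃ λ z → y ⊑ z × z ⊩ F i
      to ⊢◇Fi _ x≼y = ◇-witness φ∈F (World-≼-closed x≼y x-world) (⊩-≼-closed x≼y ⊢◇Fi)

      from : (∀ y → x ≼ y → ∃ λ z → y ⊑ z × z ⊩ F i) → x ⊩ ◇ F i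
      from ≼⊑-⊩Fi = decidable-stable (⊢◇? φ∈F Γ) λ ⊬◇Fi →
        let y-world       = Γ-prime , Maybe.just ⊬◇Fi
            _ , y⊑z , ⊢Fi = ≼⊑-⊩Fi (Γ , just i) [ x-world , y-world , id ]
            _ , i≤d       = ↾⇒ ⊑₀-refl y⊑z
        in  promise-kept (World-⊑-closed y⊑z y-world) i≤d (mp (thm T◇) ⊢Fi)

    truth : ∀ φ → All (Range F) (subformulas φ) → ∀ {x} → World x → x ⊩ φ ⇔ (⟨ model , x ⟩⊨ φ)
    truth (var p) _ x-world = mk⇔ (x-world ,_) proj₂
    truth ⊥′      _ x-world = mk⇔ (x-world ,_) proj₂
    truth (φ ∧ ψ) (_ ∷ φψ⊆F) x-world =
      let φ⊆F , ψ⊆F = ++⁻ (subformulas φ) φψ⊆F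
      in  (truth φ φ⊆F x-world ×-⇔ truth ψ ψ⊆F x-world) ⇔-∘ ⊢∧⇔⊢×⊢
    truth (φ ∨ ψ) (_ ∷ φψ⊆F) x-world =
      let φ⊆F , ψ⊆F = ++⁻ (subformulas φ) φψ⊆F
      in  (truth φ φ⊆F x-world ⊎-⇔ truth ψ ψ⊆F x-world)
            ⇔-∘ prime-⊢∨⇔⊢⊎⊢ (primeTheory x-world) (head φ⊆F) (head ψ⊆F)
    truth (φ ⇒ ψ) (_ ∷ φψ⊆F) x-world =
      let φ⊆F , ψ⊆F = ++⁻ (subformulas φ) φψ⊆F
      in  ∀-successor-cong (λ y-world → →-cong-⇔ (truth φ φ⊆F y-world) (truth ψ ψ⊆F y-world))
            World-≼-closed x-world ⇔-∘ ⊩⇒⇔ (head φ⊆F) (head ψ⊆F) x-world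
    truth (◇ φ) (_ ∷ φ⊆F) x-world =
      ∀-successor-cong (∃-successor-cong (truth φ φ⊆F) World-⊑-closed) World-≼-closed x-world
        ⇔-∘ ⊩◇⇔ (head φ⊆F) x-world
    truth (□ φ) (□φ∈F ∷ φ⊆F) x-world =
      ∀∀-successor-cong (truth φ φ⊆F) World-≼-closed World-⊑-closed x-world
        ⇔-∘ ⊩□⇔ (head φ⊆F) □φ∈F x-world

    completeness : All (Range F) (subformulas φ) → model ⊨ φ → CS4⊢ φ
    completeness {φ} φ⊆F ⊨φ =
      ⊢-closed ⟦∅⟧-empty (⊢-prime-extensions⇒⊢ (⊢? (head φ⊆F)) ∅ λ _ → prime⊢φ)
      where
      ⟦∅⟧-empty : U.Empty ⟦ ∅ ⟧
      ⟦∅⟧-empty _ (_ , i∈∅ , _) = ∉⊥ i∈∅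

      prime⊢φ : ∀ {Δ} → PrimeTheory Δ → ⟦ Δ ⟧ ⊢ φ
      prime⊢φ {Δ} Δ-prime with ⊢? ⊥∈F Δ
      ... | yes ⊢⊥ = ex-falso ⊢⊥
      ... | no  ⊬⊥ =
        Equivalence.from (truth φ φ⊆F (unpromised Δ-prime)) (⊨φ (Δ , nothing) (⊬⊥ ∘ proj₂))

  canonical-refutes : All (Range F) (subformulas φ) → ¬ (CS4⊢ φ) → ¬ (model ⊨ φ)
  canonical-refutes φ⊆F ⊬φ ⊨φ =
    ¬¬-decidable pairs-finite (λ (Γ , i) → ⟦ Γ ⟧ ⊢ F i) λ ⊢? →
    ¬¬-decidable pairs-finite (λ (Γ , i) → ⟦ Γ ⟧ ⊢ ◇ F i) λ ⊢◇? →
    let open TruthLemma (λ { (i , refl) Γ → ⊢? (Γ , i) }) (λ { (i , refl) Γ → ⊢◇? (Γ , i) })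
    in  ⊬φ (completeness φ⊆F ⊨φ)
    where
    pairs-finite : Finite (Subset n × Fin n)
    pairs-finite = ×-finite (Subset-finite n) (n , ↔-refl)

finite-model-property : ¬ (CS4⊢ φ) →
  Σ[ M ∈ CS4Model ] (Finite (CS4Model.W M) × ¬ (CS4Model.model M ⊨ φ))
finite-model-property {φ} ⊬φ =
  canonical , canonical-finite , canonical-refutes (tabulate (∈⇒Range-lookup ∘ there)) ⊬φ
  where open Canonical (lookup (⊥′ ∷ subformulas φ)) (∈⇒Range-lookup (here refl))

mainTheorem1 : (∀ (φ : Formula) → ¬ (CS4⊢ φ) →
                  Σ[ M ∈ CS4Model ] (Finite (CS4Model.W M) × ¬ (CS4Model.model M ⊨ φ)))
               × (∀ (φ : Formula) → CS4⊢ φ → ∀ (M : CS4Model) → CS4Model.model M ⊨ φ)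
mainTheorem1 = (λ _ → finite-model-property) , λ _ ⊢φ M w _ → CS4-sound M ⊢φ w
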